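{- For every infinite, countably compact topological space $Y$, the relation $\omega^{*}\rightarrow(Y)^{1}_{2}$ fails.
   Context: $\omega$ is the countably infinite discrete space, $\beta(\omega)$ its Stone-Čech compactification, and $\omega^{*}=\beta(\omega)\setminus\omega$ with the subspace topology. For topological spaces $X,Y$, the relation $X\rightarrow(Y)^{1}_{2}$ means: whenever $X=P_0\cup P_1$, there are $i\in\{0,1\}$ and $Y'\subseteq P_i$ such that $Y'$ (with the subspace topology from $X$) is homeomorphic to $Y$. -}

module Defs where

open import Data.Bool.Base using (Bool; true; false; T; not; _∧_)
open import Data.Bool.Properties using (T?; T-∧)
open import Data.Fin.Base using (Fin)
open import Data.Irrelevant using ([_])
open import Data.List.Relation.Unary.Any using (Any)
open import Data.Nat.Base using (ℕ)
open import Data.Product.Base using (∃-syntax; _×_; _,_; proj₁; proj₂)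
open import Data.Refinement using (Refinement; _,_; value)
open import Data.Sum.Base using (_⊎_; inj₁; inj₂)
open import Function.Base using (id; _∘_)
open import Function.Bundles using (_↔_; Inverse; Equivalence)
open import Level using (Level; Lift; lift; lower; suc; 0ℓ; _⊔_)
open import Relation.Binary.PropositionalEquality using (_≡_)
open import Relation.Nullary using (¬_)
open import Relation.Nullary.Decidable using (recompute)
open import Relation.Unary using (Pred; _∈_; _⊆_; _≐_; _∩_; ∁; ⋃; _⊢_)
open import Relation.Unary.Polymorphic using (U)

private
  variable
    a b : Level

-- Everything here is read classically, over the assumptions
-- ∀ {ℓ} → ExcludedMiddle ℓ and ∀ {a b} → Extensionality a b.  The former decides
-- arbitrary types, not only propositions, and so also provides choice functions.

-- Points are compared by _≡_.  Subsets of a space live in the universe of its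
-- points; under excluded middle every subset is equivalent to one of these.
-- Since _≡_ on predicates is too fine, openness has to respect _≐_.
-- The empty set is open as the union of the empty family.

record Space a : Set (suc (suc a)) where
  field
    Carrier   : Set a
    Open      : Pred (Pred Carrier a) (suc a)
    Open-resp : ∀ {V W} → V ≐ W → Open V → Open W
    Open-U    : Open U
    Open-∩    : ∀ {V W} → Open V → Open W → Open (V ∩ W)
    Open-⋃    : ∀ {I : Set a} {V : I → Pred Carrier a} →
                (∀ i → Open (V i)) → Open (⋃ I V)

open Space using (Carrier; Open; Open-resp; Open-U; Open-∩; Open-⋃)

-- The membership proof in a Refinement is irrelevant, so two points of the
-- subspace are equal exactly when they are equal in X, whatever P is.

Subspace : (X : Space a) → Pred (Carrier X) a → Space a
Subspace {a} X P = record
  { Carrier   = Refinement (Carrier X) P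
  ; Open      = λ W → ∃[ V ] Open X V × W ≐ (value ⊢ V)
  ; Open-resp = λ (W⊆W′ , W′⊆W) (V , oV , W⊆V , V⊆W) →
                  V , oV , W⊆V ∘ W′⊆W , W⊆W′ ∘ V⊆W
  ; Open-U    = U , Open-U X , id , id
  ; Open-∩    = λ (V , oV , W⊆V , V⊆W) (V′ , oV′ , W′⊆V′ , V′⊆W′) →
                  V ∩ V′ , Open-∩ X oV oV′ ,
                  (λ (w , w′) → W⊆V w , W′⊆V′ w′) ,
                  (λ (v , v′) → V⊆W v , V′⊆W′ v′)
  ; Open-⋃    = λ {I} o →
                  ⋃ I (proj₁ ∘ o) , Open-⋃ X (λ i → proj₁ (proj₂ (o i))) ,
                  (λ (i , w) → i , proj₁ (proj₂ (proj₂ (o i))) w) ,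
                  (λ (i , v) → i , proj₂ (proj₂ (proj₂ (o i))) v)
  }

-- The preimage f ⊢ V lives in the universe of Y, so its openness is expressed
-- as coincidence with an open subset of X.

Continuous : (X : Space a) (Y : Space b) → (Carrier X → Carrier Y) → Set _
Continuous X Y f = ∀ V → Open Y V → ∃[ W ] Open X W × W ≐ (f ⊢ V)

record Homeomorphism (X : Space a) (Y : Space b) : Set (suc (a ⊔ b)) where
  field
    bijection       : Carrier X ↔ Carrier Y
    to-continuous   : Continuous X Y (Inverse.to bijection)
    from-continuous : Continuous Y X (Inverse.from bijection)

Infinite : Set a → Set a
Infinite A = ¬ (∃[ n ] (A ↔ Fin n))

CountablyCompact : Space a → Set (suc a)
CountablyCompact X =
  (V : ℕ → Pred (Carrier X) _) → (∀ n → Open X (V n)) →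
  (∀ x → ∃[ n ] x ∈ V n) →
  ∃[ ns ] (∀ x → Any (λ n → x ∈ V n) ns)

infix 4 _⟶[_]¹₂

_⟶[_]¹₂ : Space a → Space b → Set (suc (a ⊔ b))
_⟶[_]¹₂ {a} X Y =
  (P : Fin 2 → Pred (Carrier X) a) → (∀ x → ∃[ i ] x ∈ P i) →
  ∃[ i ] ∃[ Y′ ] Y′ ⊆ P i × Homeomorphism (Subspace X Y′) Y

-- Subsets of ω, and families of such, as characteristic functions: classically
-- these are all the subsets, and function extensionality then makes _≡_ on
-- ultrafilters the equality of the underlying families.

℘ : Set a → Set a
℘ A = A → Bool

record IsUltrafilter (𝓕 : ℘ (℘ ℕ)) : Set where
  field
    whole  : T (𝓕 (λ _ → true))
    proper : ¬ T (𝓕 (λ _ → false))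
    upward : ∀ {A B} → (∀ n → T (A n) → T (B n)) → T (𝓕 A) → T (𝓕 B)
    meet   : ∀ {A B} → T (𝓕 A) → T (𝓕 B) → T (𝓕 (λ n → A n ∧ B n))
    ultra  : ∀ A → T (𝓕 A) ⊎ T (𝓕 (not ∘ A))

Ultrafilter : Set
Ultrafilter = Refinement (℘ (℘ ℕ)) IsUltrafilter

infix 4 _∋_

_∋_ : Ultrafilter → ℘ ℕ → Set
p ∋ A = T (value p A)

∋-whole : ∀ p → p ∋ (λ _ → true)
∋-whole (𝓕 , [ uf ]) = recompute (T? _) (IsUltrafilter.whole uf)

∋-upward : ∀ p {A B} → (∀ n → T (A n) → T (B n)) → p ∋ A → p ∋ B
∋-upward (𝓕 , [ uf ]) A⊆B A∈p =
  recompute (T? _) (IsUltrafilter.upward uf A⊆B A∈p)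

∋-meet : ∀ p {A B} → p ∋ A → p ∋ B → p ∋ (λ n → A n ∧ B n)
∋-meet (𝓕 , [ uf ]) A∈p B∈p = recompute (T? _) (IsUltrafilter.meet uf A∈p B∈p)

-- The Stone–Čech compactification of the discrete space ω: all ultrafilters on
-- ω, with the sets { q ∣ q ∋ A }, A ⊆ ω, as a base.

βω : Space 0ℓ
βω = record
  { Carrier   = Ultrafilter
  ; Open      = λ V → Lift (suc 0ℓ) (IsOpen V)
  ; Open-resp = λ (V⊆W , W⊆V) (lift o) → lift λ p p∈W →
                  let A , A∈p , A⊆V = o p (W⊆V p∈W)
                  in A , A∈p , λ q → V⊆W ∘ A⊆V q
  ; Open-U    = lift λ p _ → (λ _ → true) , ∋-whole p , λ _ _ → _
  ; Open-∩    = λ (lift o) (lift o′) → lift λ p (p∈V , p∈W) →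
                  let A , A∈p , A⊆V = o p p∈V
                      B , B∈p , B⊆W = o′ p p∈W
                  in (λ n → A n ∧ B n) , ∋-meet p A∈p B∈p , λ q A∩B∈q →
                     A⊆V q (∋-upward q (λ _ → proj₁ ∘ Equivalence.to T-∧) A∩B∈q) ,
                     B⊆W q (∋-upward q (λ _ → proj₂ ∘ Equivalence.to T-∧) A∩B∈q)
  ; Open-⋃    = λ o → lift λ p (i , p∈V) →
                  let A , A∈p , A⊆V = lower (o i) p p∈V
                  in A , A∈p , λ q q∋A → i , A⊆V q q∋A
  }
  where
  IsOpen : Pred (Pred Ultrafilter 0ℓ) 0ℓ
  IsOpen V = ∀ p → p ∈ V → ∃[ A ] p ∋ A × (∀ q → q ∋ A → q ∈ V)

-- The embedding of ω into βω.

principal : ℕ → Ultrafilter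
principal n = (λ A → A n) , [ record
  { whole  = _
  ; proper = λ ()
  ; upward = λ A⊆B → A⊆B n
  ; meet   = λ a b → Equivalence.from T-∧ (a , b)
  ; ultra  = λ A → dichotomy (A n)
  } ]
  where
  dichotomy : ∀ x → T x ⊎ T (not x)
  dichotomy true  = inj₁ _
  dichotomy false = inj₂ _

ω* : Space 0ℓ
ω* = Subspace βω (∁ (λ p → ∃[ n ] p ≡ principal n))

-- Let p be a free ultrafilter on ω.  If z is the p-limit of a discrete sequence, then the
-- values of that sequence are determined by z up to a set in p: two coordinates f, g : ω → ω
-- of z with f < g on z would yield a regressive map l with l(p) = p.  Hence a colouring of βω
-- in which every such z differs from p-most terms of one chosen sequence is constant
-- on no discrete sequence together with its p-limit.  Such a colouring exists: in a maximal partial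
-- one, an uncoloured point would have p-mostly uncoloured terms, which have p-mostly uncoloured
-- terms, and so on; each node of this tree lies on a single level, so the tree can be coloured
-- by the parity of the level.
--
-- An infinite countably compact subspace Y of ω* contains a discrete sequence with an
-- accumulation point, hence with a p-limit for some free p.  Being a discrete sequence with
-- p-limit is a property of the space Y alone, so every copy of Y in ω* contains an instance of
-- it, and the colouring for this p has no monochromatic copy of Y.

module Submission where

open import Defs
open import Axiom.ExcludedMiddle using (ExcludedMiddle)
open import Axiom.Extensionality.Propositional using (Extensionality)
open import Data.Bool.Base using (Bool; true; false; T; not; _∧_)
open import Data.Bool.Properties as Bool using (T?; T-∧; T-≡; ⇔→≡; not-¬)
open import Data.Empty using (⊥-elim)
open import Data.Fin.Base using (Fin; zero; suc)
open import Data.Irrelevant using ([_])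
open import Data.List.Base using (List; []; _∷_; _++_; lookup; deduplicate; length)
open import Data.List.Extrema.Nat using (max; xs≤max)
open import Data.List.Membership.Propositional using (find) renaming (_∈_ to _∈ˡ_)
open import Data.List.Membership.Propositional.Properties
  using (∈-++⁺ˡ; ∈-++⁺ʳ; ∈-lookup; ∈-deduplicate⁺)
open import Data.List.Relation.Unary.All as All using ()
open import Data.List.Relation.Unary.AllPairs using (_∷_)
open import Data.List.Relation.Unary.Any as Any using (here)
open import Data.List.Relation.Unary.Any.Properties using (lookup-index)
open import Data.List.Relation.Unary.Unique.Propositional using (Unique)
import Data.List.Relation.Unary.Unique.DecPropositional.Properties as DecUnique
open import Data.Nat.Base using (ℕ; zero; suc; _≤_; _<_; _<′_; <′-base; ≤′-step)
open import Data.Nat.GeneralisedArithmetic using (fold; fold-+)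
open import Data.Nat.Properties
  using (<-cmp; _<?_; <-irrefl; <-≤-trans; n<1+n; m<n⇒m<1+n; m<1+n⇒m<n∨m≡n; +-comm;
         m≤n⇒∃[o]m+o≡n; <⇒<′; ≤-pred)
open import Data.Product.Base using (∃-syntax; _×_; _,_; proj₁; proj₂)
open import Data.Refinement using (_,_; value; value-injective)
open import Data.Sum.Base using (_⊎_; inj₁; inj₂; [_,_]′)
open import Data.Unit.Base using (⊤; tt)
open import Function.Base using (id; const; _∘_; _$_; case_of_)
open import Function.Bundles using (_↔_; Inverse; Equivalence; mk⇔; mk↔ₛ′)
open import Level using (Level; lift; 0ℓ)
open import Relation.Binary.Definitions using (tri<; tri≈; tri>)
open import Relation.Binary.PropositionalEquality
  using (_≡_; _≢_; refl; sym; trans; cong; subst)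
open import Relation.Nullary using (¬_; Dec; yes; no; does; contradiction)
open import Relation.Nullary.Decidable using (recompute; _⊎-dec_; decidable-stable)
open import Relation.Unary using (Pred; _∈_; _∉_; _⊆_; _≐_; _⊢_)

private
  variable
    a b c : Level
    A : Set a

-- Ultrafilters and the quantifier "for u-most n".

∋-ultra : ∀ u S → (u ∋ S) ⊎ (u ∋ not ∘ S)
∋-ultra (𝓕 , [ uf ]) S = recompute (T? _ ⊎-dec T? _) (IsUltrafilter.ultra uf S)

∋-proper : ∀ u → ¬ (u ∋ const false)
∋-proper (𝓕 , [ uf ]) ∅∈u = recompute (no id) (IsUltrafilter.proper uf ∅∈u)

T-not⇒¬T : ∀ x → T (not x) → ¬ T x
T-not⇒¬T false _ ()

∋-not : ∀ u {S} → u ∋ S → ¬ (u ∋ not ∘ S)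
∋-not u {S} S∈u ∁S∈u = ∋-proper u (∋-upward u
  (λ n t → let s , s̸ = Equivalence.to (T-∧ {S n}) t in T-not⇒¬T (S n) s̸ s)
  (∋-meet u S∈u ∁S∈u))

pushforward : (ℕ → ℕ) → Ultrafilter → Ultrafilter
pushforward f (𝓕 , [ uf ]) = (λ S → 𝓕 (S ∘ f)) , [ record
  { whole  = IsUltrafilter.whole uf
  ; proper = IsUltrafilter.proper uf
  ; upward = λ S⊆S′ → IsUltrafilter.upward uf (S⊆S′ ∘ f)
  ; meet   = IsUltrafilter.meet uf
  ; ultra  = λ S → IsUltrafilter.ultra uf (S ∘ f)
  } ]

lookup-injective : {xs : List A} → Unique xs → ∀ {i j} → lookup xs i ≡ lookup xs j → i ≡ j
lookup-injective (_ ∷ _)   {zero}  {zero}  _ = refl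
lookup-injective (x∉ ∷ _)  {zero}  {suc j} e = contradiction e (All.lookup x∉ (∈-lookup j))
lookup-injective (x∉ ∷ _)  {suc i} {zero}  e = contradiction (sym e) (All.lookup x∉ (∈-lookup i))
lookup-injective (_ ∷ xs!) {suc i} {suc j} e = cong suc (lookup-injective xs! e)

module Classical
  (em : ∀ {ℓ} → ExcludedMiddle ℓ)
  (ext : ∀ {a b} → Extensionality a b)
  where

  stable : ¬ ¬ A → A
  stable = decidable-stable em

  ⌊_⌋ : Pred A b → ℘ A
  ⌊ P ⌋ x = does (em {P = P x})

  ⌊⌋⁺ : (P : Pred A b) → ∀ {x} → P x → T (⌊ P ⌋ x)
  ⌊⌋⁺ P {x} Px with em {P = P x}
  ... | yes _  = tt
  ... | no ¬Px = ¬Px Px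

  ⌊⌋⁻ : (P : Pred A b) → ∀ {x} → T (⌊ P ⌋ x) → P x
  ⌊⌋⁻ P {x} t with em {P = P x}
  ... | yes Px = Px

  infix 4 _⊑_

  _⊑_ : ℘ A → ℘ A → Set _
  M ⊑ N = ∀ x → T (M x) → T (N x)

  ⊑-antisym : {M N : ℘ A} → M ⊑ N → N ⊑ M → M ≡ N
  ⊑-antisym M⊑N N⊑M = ext λ x → ⇔→≡ {z = true} $ mk⇔
    (Equivalence.to T-≡ ∘ M⊑N x ∘ Equivalence.from T-≡)
    (Equivalence.to T-≡ ∘ N⊑M x ∘ Equivalence.from T-≡)

  -- A record rather than a synonym, so that u and P can be inferred.
  record ∀ᶠ (u : Ultrafilter) (P : Pred ℕ b) : Set where
    constructor eventually
    field ∋⌊⌋ : u ∋ ⌊ P ⌋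

  open ∀ᶠ

  module _ {u : Ultrafilter} where

    ∀ᶠ⁺ : ∀ {S} → u ∋ S → ∀ᶠ u (T ∘ S)
    ∀ᶠ⁺ {S} = eventually ∘ ∋-upward u λ _ → ⌊⌋⁺ (T ∘ S)

    ∀ᶠ⁻ : ∀ {S} → ∀ᶠ u (T ∘ S) → u ∋ S
    ∀ᶠ⁻ {S} = (∋-upward u λ _ → ⌊⌋⁻ (T ∘ S)) ∘ ∋⌊⌋

    ∀ᶠ-map : {P : Pred ℕ a} {Q : Pred ℕ b} →
             (∀ n → P n → Q n) → ∀ᶠ u P → ∀ᶠ u Q
    ∀ᶠ-map {P = P} {Q} f = eventually ∘ ∋-upward u (λ n → ⌊⌋⁺ Q ∘ f n ∘ ⌊⌋⁻ P) ∘ ∋⌊⌋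

    ∀ᶠ-zip : {P : Pred ℕ a} {Q : Pred ℕ b} {R : Pred ℕ c} →
             (∀ n → P n → Q n → R n) → ∀ᶠ u P → ∀ᶠ u Q → ∀ᶠ u R
    ∀ᶠ-zip {P = P} {Q} {R} f (eventually P∈u) (eventually Q∈u) = eventually $ ∋-upward u
      (λ n t → let p , q = Equivalence.to (T-∧ {⌊ P ⌋ n}) t
               in ⌊⌋⁺ R (f n (⌊⌋⁻ P p) (⌊⌋⁻ Q q)))
      (∋-meet u P∈u Q∈u)

    ∀ᶠ-∩ : {P : Pred ℕ a} {Q : Pred ℕ b} → ∀ᶠ u P → ∀ᶠ u Q → ∀ᶠ u (λ n → P n × Q n)
    ∀ᶠ-∩ = ∀ᶠ-zip λ _ → _,_

    module _ {P : Pred ℕ a} where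

      ∀⇒∀ᶠ : (∀ n → P n) → ∀ᶠ u P
      ∀⇒∀ᶠ f = eventually $ ∋-upward u (λ n _ → ⌊⌋⁺ P (f n)) (∋-whole u)

      ∀ᶠ-ultra : ∀ᶠ u P ⊎ ∀ᶠ u (¬_ ∘ P)
      ∀ᶠ-ultra with ∋-ultra u ⌊ P ⌋
      ... | inj₁ P∈u  = inj₁ (eventually P∈u)
      ... | inj₂ ¬P∈u = inj₂ $ eventually $ ∋-upward u
        (λ n t → ⌊⌋⁺ (¬_ ∘ P) λ Pn → T-not⇒¬T (⌊ P ⌋ n) t (⌊⌋⁺ P Pn)) ¬P∈u

      ¬∀ᶠ⇒∀ᶠ¬ : ¬ ∀ᶠ u P → ∀ᶠ u (¬_ ∘ P)
      ¬∀ᶠ⇒∀ᶠ¬ ¬P = [ (λ P∈u → contradiction P∈u ¬P) , id ]′ ∀ᶠ-ultra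

      ∀ᶠ⇒∃ : ∀ᶠ u P → ∃[ n ] P n
      ∀ᶠ⇒∃ (eventually P∈u) = stable λ ¬∃ →
        ∋-proper u (∋-upward u (λ n t → ¬∃ (n , ⌊⌋⁻ P t)) P∈u)

    ∀ᶠ-absurd : {P : Pred ℕ a} {Q : Pred ℕ b} → (∀ n → P n → ¬ Q n) → ∀ᶠ u P → ¬ ∀ᶠ u Q
    ∀ᶠ-absurd f P∈u Q∈u = proj₂ (∀ᶠ⇒∃ (∀ᶠ-zip f P∈u Q∈u))

  -- Ultrafilters are maximal: via complements, inclusion of `u` in `v` already forces equality.
  separate : ∀ {u v} → u ≢ v → ∃[ S ] u ∋ S × ¬ (v ∋ S)
  separate {u} {v} u≢v = stable λ ¬sep →
    let u⊑v : value u ⊑ value v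
        u⊑v S S∈u = stable λ S∉v → ¬sep (S , S∈u , S∉v)
        v⊑u : value v ⊑ value u
        v⊑u S S∈v = [ id , (λ ∁S∈u → contradiction (u⊑v _ ∁S∈u) (∋-not v S∈v)) ]′
                    (∋-ultra u S)
    in u≢v (value-injective (⊑-antisym u⊑v v⊑u))

  -- Uniqueness of discrete sequences with a given p-limit.

  -- z is the p-limit of the sequence us, and f witnesses that this sequence is discrete.
  record IsSum (p : Ultrafilter) (us : ℕ → Ultrafilter) (f : ℕ → ℕ) (z : Ultrafilter) : Set where
    field
      fibre : ∀ n → ∀ᶠ (us n) (λ k → f k ≡ n)
      limit : ∀ {S} → z ∋ S → ∀ᶠ p (λ n → us n ∋ S)

    push : {P : Pred ℕ b} → ∀ᶠ z P → ∀ᶠ p (λ n → ∀ᶠ (us n) λ k → f k ≡ n × P k)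
    push (eventually P∈z) =
      ∀ᶠ-map (λ n P∈uₙ → ∀ᶠ-∩ (fibre n) (eventually P∈uₙ)) (limit P∈z)

    -- The converse of `push`: if `z` did not contain `P`, it would contain the complement, and
    -- pushing that to the terms contradicts the hypothesis.
    pull : {P : Pred ℕ b} → ∀ᶠ p (λ n → ∀ᶠ (us n) λ k → f k ≡ n → P k) → ∀ᶠ z P
    pull P∈us with ∀ᶠ-ultra
    ... | inj₁ P∈z  = P∈z
    ... | inj₂ ¬P∈z = ⊥-elim $
      ∀ᶠ-absurd (λ n → ∀ᶠ-absurd λ k P (fk≡n , ¬P) → ¬P (P fk≡n)) P∈us (push ¬P∈z)

  open IsSum

  -- The colour is the parity of the descent `m`, `l m`, and so on, as long as it decreases. The
  -- first argument of `colour` is fuel, of which any amount above `m` suffices.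
  regressive-colouring : ∀ (l : ℕ → ℕ) → ∃[ r ] (∀ m → l m < m → r m ≡ not (r (l m)))
  regressive-colouring l = (λ m → colour (suc m) m) , λ m lm<m →
    trans (colour-step m m lm<m) (cong not (colour-fuel m (suc (l m)) lm<m (n<1+n _)))
    where
    colour : ℕ → ℕ → Bool
    colour zero    m = true
    colour (suc i) m with l m <? m
    ... | yes _ = not (colour i (l m))
    ... | no  _ = true

    colour-step : ∀ i m → l m < m → colour (suc i) m ≡ not (colour i (l m))
    colour-step i m lm<m with l m <? m
    ... | yes _    = refl
    ... | no lm≮m = contradiction lm<m lm≮m

    colour-fuel : ∀ i j {m} → m < i → m < j → colour i m ≡ colour j m
    colour-fuel (suc i) (suc j) {m} m<i m<j with l m <? m
    ... | yes lm<m = cong not $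
      colour-fuel i j (<-≤-trans lm<m (≤-pred m<i)) (<-≤-trans lm<m (≤-pred m<j))
    ... | no  _    = refl

  bounded⇒constant : ∀ {u} (f : ℕ → ℕ) m → ∀ᶠ u (λ k → f k < m) →
                     ∃[ l ] l < m × ∀ᶠ u (λ k → f k ≡ l)
  bounded⇒constant {u} f zero f<0 with () ← proj₂ (∀ᶠ⇒∃ f<0)
  bounded⇒constant {u} f (suc m) f<1+m with ∀ᶠ-ultra {P = λ k → f k ≡ m}
  ... | inj₁ f≡m = m , n<1+n m , f≡m
  ... | inj₂ f≢m =
    let l , l<m , f≡l = bounded⇒constant {u} f m
          (∀ᶠ-zip (λ k f<1+m f≢m → [ id , (λ f≡m → contradiction f≡m f≢m) ]′
            (m<1+n⇒m<n∨m≡n f<1+m)) f<1+m f≢m)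
    in l , m<n⇒m<1+n l<m , f≡l

  module _ {p z us vs f g} (Σu : IsSum p us f z) (Σv : IsSum p vs g z) where

    -- If f < g on z, then f takes a constant value l m < m on vs m, and l maps p to itself;
    -- this is incompatible with a 2-colouring that separates m from l m.
    coordinates-≮ : ¬ ∀ᶠ z (λ k → f k < g k)
    coordinates-≮ f<g = monochromatic ∀ᶠ-ultra
      where
      Value : ℕ → Set
      Value m = ∃[ l ] l < m × ∀ᶠ (vs m) (λ k → f k ≡ l)

      l : ℕ → ℕ
      l m with em {P = Value m}
      ... | yes (l , _) = l
      ... | no _        = m

      l-value : ∀ m → Value m → l m < m × ∀ᶠ (vs m) (λ k → f k ≡ l m)
      l-value m v with em {P = Value m}
      ... | yes (_ , lv) = lv
      ... | no ¬v        = contradiction v ¬v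

      r : ℕ → Bool
      r = proj₁ (regressive-colouring l)

      values : ∀ᶠ p Value
      values = ∀ᶠ-map (λ m H → bounded⇒constant {vs m} f m
        (∀ᶠ-map (λ { k (refl , f<g) → f<g }) H)) (push Σv f<g)

      -- Through `Σu`, `f` maps `z` to `p`, so `P ∘ r ∘ f` holds on `z`. Through `Σv` it then holds
      -- on `vs m` for p-most `m`, where `f` has the constant value `l m`.
      transfer : {P : Pred Bool 0ℓ} → ∀ᶠ p (P ∘ r) → ∀ᶠ p (λ m → P (r (l m)))
      transfer {P} Pr = ∀ᶠ-zip at values
        (push Σv {P = P ∘ r ∘ f} (pull Σu (∀ᶠ-map (λ n Prn → ∀⇒∀ᶠ λ { k refl → Prn }) Pr)))
        where
        at : ∀ m → Value m → ∀ᶠ (vs m) (λ k → g k ≡ m × P (r (f k))) → P (r (l m))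
        at m v H = let k , fk≡l , _ , Prf = ∀ᶠ⇒∃ (∀ᶠ-∩ (proj₂ (l-value m v)) H)
                   in subst (P ∘ r) fk≡l Prf

      impossible : {P : Pred Bool 0ℓ} → (∀ x → P x → ¬ P (not x)) → ¬ ∀ᶠ p (P ∘ r)
      impossible {P} P! Pr = ∀ᶠ-absurd
        (λ m v (Prm , Prlm) → P! _ Prlm
          (subst P (proj₂ (regressive-colouring l) m (proj₁ (l-value m v))) Prm))
        values (∀ᶠ-∩ Pr (transfer {P} Pr))

      monochromatic : ¬ (∀ᶠ p (T ∘ r) ⊎ ∀ᶠ p (¬_ ∘ T ∘ r))
      monochromatic (inj₁ H) = impossible {T} (λ { true _ () }) H
      monochromatic (inj₂ H) = impossible {¬_ ∘ T} (λ { true h _ → h tt ; false _ h → h tt }) H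

  -- Two applications of `coordinates-≮` make the index functions agree on `z`, so both sequences
  -- can be compared fibre by fibre.
  sum-unique : ∀ {p z us vs f g} → IsSum p us f z → IsSum p vs g z → ∀ᶠ p (λ n → us n ≡ vs n)
  sum-unique {p} {z} {us} {vs} {f} {g} Σu Σv = [ id , (λ H → ⊥-elim (differ H)) ]′ ∀ᶠ-ultra
    where
    f≡g : ∀ᶠ z (λ k → f k ≡ g k)
    f≡g = ∀ᶠ-zip compare
      (¬∀ᶠ⇒∀ᶠ¬ (coordinates-≮ Σu Σv)) (¬∀ᶠ⇒∀ᶠ¬ (coordinates-≮ Σv Σu))
      where
      compare : ∀ k → ¬ f k < g k → ¬ g k < f k → f k ≡ g k
      compare k f≮g g≮f with <-cmp (f k) (g k)
      ... | tri< f<g _ _ = contradiction f<g f≮g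
      ... | tri≈ _ e _   = e
      ... | tri> _ _ g<f = contradiction g<f g≮f

    Sep : ℕ → Set
    Sep n = ∃[ S ] us n ∋ S × ¬ (vs n ∋ S)

    S : ℕ → ℘ ℕ
    S n with em {P = Sep n}
    ... | yes (S , _) = S
    ... | no _        = const true

    S-separates : ∀ n → Sep n → us n ∋ S n × ¬ (vs n ∋ S n)
    S-separates n s with em {P = Sep n}
    ... | yes (_ , h) = h
    ... | no ¬s       = contradiction s ¬s

    differ : ¬ ∀ᶠ p (λ n → us n ≢ vs n)
    differ u≢v = ∀ᶠ-absurd
      (λ m u≢v H → proj₂ (S-separates m (separate u≢v))
        (∀ᶠ⁻ (∀ᶠ-map (λ { k (refl , fk≡m , s) → subst (λ n → T (S n k)) fk≡m s }) H)))
      u≢v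
      -- The separating sets are glued along the fibres of `f` into one set. It lies in `z` because
      -- of `us`, and hence forces `S m` into `vs m` for p-most `m`.
      (push Σv {P = λ k → f k ≡ g k × T (S (f k) k)} $ pull Σu $ ∀ᶠ-zip
        (λ n u≢v H → ∀ᶠ-zip (λ { k (_ , e) s refl → e , s }) H
          (∀ᶠ⁺ (proj₁ (S-separates n (separate u≢v)))))
        u≢v (push Σu f≡g))

  -- Zorn's lemma for families of subsets.

  ⨆ : ℘ (℘ A) → ℘ A
  ⨆ 𝓢 = ⌊ (λ x → ∃[ M ] T (𝓢 M) × T (M x)) ⌋

  ⨆-upper : ∀ {𝓢 : ℘ (℘ A)} {M} → T (𝓢 M) → M ⊑ ⨆ 𝓢
  ⨆-upper {𝓢 = 𝓢} M∈𝓢 x x∈M = ⌊⌋⁺ (λ x → ∃[ M ] T (𝓢 M) × T (M x)) (_ , M∈𝓢 , x∈M)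

  ⨆⁻ : ∀ (𝓢 : ℘ (℘ A)) {x} → T (⨆ 𝓢 x) → ∃[ M ] T (𝓢 M) × T (M x)
  ⨆⁻ 𝓢 = ⌊⌋⁻ (λ x → ∃[ M ] T (𝓢 M) × T (M x))

  ⨆-least : ∀ {𝓢 : ℘ (℘ A)} {N} → (∀ M → T (𝓢 M) → M ⊑ N) → ⨆ 𝓢 ⊑ N
  ⨆-least {𝓢 = 𝓢} 𝓢⊑N x t = let M , M∈𝓢 , x∈M = ⨆⁻ 𝓢 t in 𝓢⊑N M M∈𝓢 x x∈M

  -- The Bourbaki–Witt tower of an inflationary map.  Families being Bool-valued, the
  -- family of all stages is again of type ℘ (℘ A), at the same level.
  module Tower {A : Set a} (next : ℘ A → ℘ A) (⊑-next : ∀ M → M ⊑ next M) where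

    data Stage : ℘ A → Set a where
      step : ∀ {M} → Stage M → Stage (next M)
      sup  : ∀ 𝓢 → (∀ M → T (𝓢 M) → Stage M) → Stage (⨆ 𝓢)

    -- The auxiliary notion of the Bourbaki-Witt argument: it supplies the successor case of
    -- `comparable`, and `stage-extreme` then shows that all stages have it.
    Extreme : ℘ A → Set a
    Extreme N = ∀ {M} → Stage M → M ⊑ N → M ≡ N ⊎ next M ⊑ N

    comparable : ∀ {M N} → Extreme N → Stage M → M ⊑ N ⊎ next N ⊑ M
    comparable {_} {N} extreme (step {M} s) with comparable extreme s
    ... | inj₂ N⁺⊑M = inj₂ λ x → ⊑-next M x ∘ N⁺⊑M x
    ... | inj₁ M⊑N with extreme s M⊑N
    ...   | inj₁ refl = inj₂ λ _ → id
    ...   | inj₂ M⁺⊑N = inj₁ M⁺⊑N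
    comparable {_} {N} extreme (sup 𝓢 s) with em {P = ∃[ M ] T (𝓢 M) × ¬ (M ⊑ N)}
    ... | no ¬∃ = inj₁ (⨆-least λ M M∈𝓢 → stable λ M⋢N → ¬∃ (M , M∈𝓢 , M⋢N))
    ... | yes (M , M∈𝓢 , M⋢N) with comparable extreme (s M M∈𝓢)
    ...   | inj₁ M⊑N  = contradiction M⊑N M⋢N
    ...   | inj₂ N⁺⊑M = inj₂ λ x → ⨆-upper M∈𝓢 x ∘ N⁺⊑M x

    stage-extreme : ∀ {N} → Stage N → Extreme N
    stage-extreme (step {N} s) {M} t M⊑N⁺ with comparable (stage-extreme s) t
    ... | inj₂ N⁺⊑M = inj₁ (⊑-antisym M⊑N⁺ N⁺⊑M)
    ... | inj₁ M⊑N with stage-extreme s t M⊑N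
    ...   | inj₁ refl = inj₂ λ _ → id
    ...   | inj₂ M⁺⊑N = inj₂ λ x → ⊑-next N x ∘ M⁺⊑N x
    stage-extreme (sup 𝓢 s) {M} t M⊑⨆ with em {P = ∃[ N ] T (𝓢 N) × ¬ (N ⊑ M)}
    ... | no ¬∃ = inj₁ $ ⊑-antisym M⊑⨆ $
      ⨆-least λ N N∈𝓢 → stable λ N⋢M → ¬∃ (N , N∈𝓢 , N⋢M)
    ... | yes (N , N∈𝓢 , N⋢M) with comparable (stage-extreme (s N N∈𝓢)) t
    ...   | inj₂ N⁺⊑M = contradiction (λ x → N⁺⊑M x ∘ ⊑-next N x) N⋢M
    ...   | inj₁ M⊑N with stage-extreme (s N N∈𝓢) t M⊑N
    ...     | inj₁ refl = contradiction (λ _ → id) N⋢M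
    ...     | inj₂ M⁺⊑N = inj₂ λ x → ⨆-upper N∈𝓢 x ∘ M⁺⊑N x

    stages-chain : ∀ {M N} → Stage M → Stage N → M ⊑ N ⊎ N ⊑ M
    stages-chain {N = N} s t with comparable (stage-extreme t) s
    ... | inj₁ M⊑N  = inj₁ M⊑N
    ... | inj₂ N⁺⊑M = inj₂ λ x → N⁺⊑M x ∘ ⊑-next N x

    top : ℘ A
    top = ⨆ ⌊ Stage ⌋

    top-stage : Stage top
    top-stage = sup ⌊ Stage ⌋ λ _ → ⌊⌋⁻ Stage

    -- `top` is itself a stage, so its successor is among the stages whose union is `top`.
    next-top : next top ⊑ top
    next-top = ⨆-upper (⌊⌋⁺ Stage (step top-stage))

  -- The tower of a map that picks a strictly larger member of `P` whenever there is one; at `top`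
  -- this map stops growing. The tower starts from the empty union.
  zorn : {A : Set a} (P : Pred (℘ A) b) →
         (∀ 𝓢 → (∀ M → T (𝓢 M) → P M) →
                (∀ M N → T (𝓢 M) → T (𝓢 N) → M ⊑ N ⊎ N ⊑ M) →
                P (⨆ 𝓢)) →
         ∃[ M ] P M × (∀ N → P N → M ⊑ N → N ⊑ M)
  zorn {A = A} P P-⨆ = top , P-top , maximal
    where
    Larger : ℘ A → Pred (℘ A) _
    Larger M N = P N × M ⊑ N × ¬ (N ⊑ M)

    next : ℘ A → ℘ A
    next M with em {P = ∃[ N ] Larger M N}
    ... | yes (N , _) = N
    ... | no _        = M

    ⊑-next : ∀ M → M ⊑ next M
    ⊑-next M with em {P = ∃[ N ] Larger M N}
    ... | yes (_ , _ , M⊑N , _) = M⊑N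
    ... | no _                  = λ _ → id

    P-next : ∀ M → P M → P (next M)
    P-next M PM with em {P = ∃[ N ] Larger M N}
    ... | yes (_ , PN , _) = PN
    ... | no _             = PM

    next-larger : ∀ M → ∃[ N ] Larger M N → ¬ (next M ⊑ M)
    next-larger M ∃N with em {P = ∃[ N ] Larger M N}
    ... | yes (_ , _ , _ , N⋢M) = N⋢M
    ... | no ∄N                 = contradiction ∃N ∄N

    open Tower next ⊑-next

    P-stage : ∀ {M} → Stage M → P M
    P-stage (step s)  = P-next _ (P-stage s)
    P-stage (sup 𝓢 s) = P-⨆ 𝓢 (λ M M∈𝓢 → P-stage (s M M∈𝓢))
      λ M N M∈𝓢 N∈𝓢 → stages-chain (s M M∈𝓢) (s N N∈𝓢)

    P-top : P top
    P-top = P-stage top-stage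

    maximal : ∀ N → P N → top ⊑ N → N ⊑ top
    maximal N PN top⊑N = stable λ N⋢top → next-larger top (N , PN , top⊑N , N⋢top) next-top

  -- The colouring of βω for a free ultrafilter `p`.

  NonPrincipal : Ultrafilter → Set
  NonPrincipal p = ∀ n → ∀ᶠ p (_≢ n)

  module Colouring (p : Ultrafilter) (p-free : NonPrincipal p) where

    Summable : Ultrafilter → Set
    Summable z = ∃[ us ] ∃[ f ] IsSum p us f z

    summands : Ultrafilter → ℕ → Ultrafilter
    summands z with em {P = Summable z}
    ... | yes (us , _) = us
    ... | no _         = const z

    index : Ultrafilter → ℕ → ℕ
    index z with em {P = Summable z}
    ... | yes (_ , f , _) = f
    ... | no _            = const 0

    isSum : ∀ {z} → Summable z → IsSum p (summands z) (index z) z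
    isSum {z} s with em {P = Summable z}
    ... | yes (_ , _ , Σz) = Σz
    ... | no ¬s            = contradiction s ¬s

    -- Partial colourings are encoded as graphs, so that extension is `⊑` and `zorn` applies.
    Partial : Set
    Partial = ℘ (Ultrafilter × Bool)

    -- `alternating` requires p-most summands of a coloured point to be coloured as well. Thus it
    -- survives any extension of `M` and has to be checked only at new points.
    record Good (M : Partial) : Set where
      field
        functional  : ∀ {z x y} → T (M (z , x)) → T (M (z , y)) → x ≡ y
        alternating : ∀ {z x} → T (M (z , x)) → Summable z →
                      ∀ᶠ p (λ n → T (M (summands z n , not x)))

    open Good

    maximal-good : ∃[ M ] Good M × (∀ N → Good N → M ⊑ N → N ⊑ M)
    maximal-good = zorn Good λ 𝓢 good chain → record
      { functional = λ t t′ →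
          let M , M∈𝓢 , x∈M = ⨆⁻ 𝓢 t
              N , N∈𝓢 , y∈N = ⨆⁻ 𝓢 t′
          in [ (λ M⊑N → functional (good N N∈𝓢) (M⊑N _ x∈M) y∈N)
             , (λ N⊑M → functional (good M M∈𝓢) x∈M (N⊑M _ y∈N)) ]′ (chain M N M∈𝓢 N∈𝓢)
      ; alternating = λ t s →
          let M , M∈𝓢 , x∈M = ⨆⁻ 𝓢 t
          in ∀ᶠ-map (λ n → ⨆-upper M∈𝓢 _) (alternating (good M M∈𝓢) x∈M s)
      }

    -- The summand of z whose fibre contains k.  Iterating θ k from x descends the tree of
    -- summands below x, and z lies on its m-th level if z-most k lead to z in m steps.
    θ : ℕ → Ultrafilter → Ultrafilter
    θ k z = summands z (index z k)

    Level-of : Ultrafilter → ℕ → Ultrafilter → Set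
    Level-of x m z = ∀ᶠ z (λ k → fold x (θ k) m ≡ z)

    module Extension {M : Partial} (good : Good M)
                     (maximal : ∀ N → Good N → M ⊑ N → N ⊑ M) where

      Uncoloured : Ultrafilter → Set
      Uncoloured z = ∀ x → ¬ T (M (z , x))

      -- `M` together with `Q` would be good, so by maximality `Q` lies in `M`, although its points
      -- are uncoloured.
      extend : (Q : Pred (Ultrafilter × Bool) 0ℓ) →
               (∀ {z x} → Q (z , x) → Uncoloured z) →
               (∀ {z x y} → Q (z , x) → Q (z , y) → x ≡ y) →
               (∀ {z x} → Q (z , x) → Summable z →
                 ∀ᶠ p λ n → T (M (summands z n , not x)) ⊎ Q (summands z n , not x)) →
               ∀ {z x} → ¬ Q (z , x)
      extend Q new Q-functional Q-alternating {z} {x} q =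
        new q x (maximal ⌊ N ⌋ N-good (λ _ → ⌊⌋⁺ N ∘ inj₁) (z , x) (⌊⌋⁺ N (inj₂ q)))
        where
        N : Pred (Ultrafilter × Bool) 0ℓ
        N e = T (M e) ⊎ Q e

        N-functional : ∀ {z x y} → N (z , x) → N (z , y) → x ≡ y
        N-functional (inj₁ t) (inj₁ t′) = functional good t t′
        N-functional (inj₁ t) (inj₂ q′) = contradiction t (new q′ _)
        N-functional (inj₂ q) (inj₁ t′) = contradiction t′ (new q _)
        N-functional (inj₂ q) (inj₂ q′) = Q-functional q q′

        N-alternating : ∀ {z x} → N (z , x) → Summable z → ∀ᶠ p λ n → N (summands z n , not x)
        N-alternating (inj₁ t) s = ∀ᶠ-map (λ _ → inj₁) (alternating good t s)
        N-alternating (inj₂ q) s = Q-alternating q s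

        N-good : Good ⌊ N ⌋
        N-good = record
          { functional  = λ t t′ → N-functional (⌊⌋⁻ N t) (⌊⌋⁻ N t′)
          ; alternating = λ t s → ∀ᶠ-map (λ _ → ⌊⌋⁺ N) (N-alternating (⌊⌋⁻ N t) s)
          }

      -- Otherwise M could be extended by the colour x for z alone.
      no-single : ∀ {z} x → Uncoloured z →
                  ¬ (Summable z → ∀ᶠ p λ n → T (M (summands z n , not x)))
      no-single {z} x z∉M alt = extend ((z , x) ≡_)
        (λ { refl → z∉M }) (λ { refl refl → refl })
        (λ { refl s → ∀ᶠ-map (λ _ → inj₁) (alt s) }) refl

      -- At a point that is no p-limit of the required kind, alternation is vacuous and any colour
      -- could be added.
      uncoloured-summable : ∀ {z} → Uncoloured z → Summable z
      uncoloured-summable z∉M = stable λ ¬s → no-single true z∉M (λ s → contradiction s ¬s)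

      -- If p-most summands had one and the same colour, `z` could take the other one.
      uncoloured-summands : ∀ {z} → Uncoloured z → ∀ᶠ p (Uncoloured ∘ summands z)
      uncoloured-summands z∉M = ∀ᶠ-zip (λ { n ¬t ¬f true → ¬t ; n ¬t ¬f false → ¬f })
        (¬∀ᶠ⇒∀ᶠ¬ (no-single false z∉M ∘ const)) (¬∀ᶠ⇒∀ᶠ¬ (no-single true z∉M ∘ const))

      push-index : ∀ {z} {P : Pred ℕ b} → Uncoloured z → ∀ᶠ z P →
                   ∀ᶠ p (λ n → ∀ᶠ (summands z n) λ k → index z k ≡ n × P k)
      push-index z∉M = push (isSum (uncoloured-summable z∉M))

      -- Passing to summands reduces to a single step. There p-most summands of `y` equal `z`; as
      -- `p` is free, two of different index do, but their fibres are disjoint.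
      no-return : ∀ d {y z} → Uncoloured y → ¬ ∀ᶠ y (λ k → fold y (θ k) (suc d) ≡ z)
      no-return zero {y} {z} y∉M H =
        let n , uₙ≡z      = ∀ᶠ⇒∃ constant
            m , uₘ≡z , m≢n = ∀ᶠ⇒∃ (∀ᶠ-∩ constant (p-free n))
            at : ∀ i → summands y i ≡ z → ∀ᶠ z (λ k → index y k ≡ i)
            at i uᵢ≡z = subst (λ u → ∀ᶠ u _) uᵢ≡z (fibre Σy i)
        in ∀ᶠ-absurd (λ k eₘ eₙ → m≢n (trans (sym eₘ) eₙ)) (at m uₘ≡z) (at n uₙ≡z)
        where
        Σy : IsSum p (summands y) (index y) y
        Σy = isSum (uncoloured-summable y∉M)

        constant : ∀ᶠ p (λ n → summands y n ≡ z)
        constant = ∀ᶠ-map (λ { n h → case ∀ᶠ⇒∃ h of λ { (_ , refl , e) → e } }) (push Σy H)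

      no-return (suc d) {y} {z} y∉M H =
        ∀ᶠ-absurd (λ n u∉M h → no-return d u∉M (∀ᶠ-map (λ { k (refl , e) → trans (shift k) e }) h))
          (uncoloured-summands y∉M) (push-index y∉M H)
        where
        shift : ∀ k → fold (θ k y) (θ k) (suc d) ≡ fold y (θ k) (suc (suc d))
        shift k = trans (sym (fold-+ y (θ k) (suc d))) (cong (fold y (θ k)) (+-comm (suc d) 1))

      -- With `n` equal to `m + d + 1`, z-most `k` would lead from `z` back to `z` in `d + 1` steps.
      level-< : ∀ {x z m n} → Uncoloured z → Level-of x m z → Level-of x n z → ¬ m < n
      level-< {x} {z} {m} z∉M hm hn m<n with d , refl ← m≤n⇒∃[o]m+o≡n m<n =
        no-return d z∉M (∀ᶠ-zip (λ k eₘ eₙ →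
          trans (sym (trans (cong (fold x (θ k)) (cong suc (+-comm m d)))
                     (trans (fold-+ x (θ k) (suc d)) (cong (λ y → fold y (θ k) (suc d)) eₘ)))) eₙ) hm hn)

      level-unique : ∀ {x z m n} → Uncoloured z → Level-of x m z → Level-of x n z → m ≡ n
      level-unique {m = m} {n} z∉M hm hn with <-cmp m n
      ... | tri< m<n _ _ = contradiction m<n (level-< {m = m} {n} z∉M hm hn)
      ... | tri≈ _ e _   = e
      ... | tri> _ _ n<m = contradiction n<m (level-< {m = n} {m} z∉M hn hm)

      level-suc : ∀ {x z m} → Uncoloured z → Level-of x m z →
                  ∀ᶠ p (λ n → Level-of x (suc m) (summands z n))
      level-suc {x} {z} {m} z∉M hm = ∀ᶠ-map (λ n → ∀ᶠ-map λ { k (refl , e) → cong (θ k) e })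
        (push-index z∉M hm)

      -- An uncoloured `z` is the root, on level 0, of a tree of uncoloured points. Parity of level
      -- is well defined there by `level-unique` and alternates by `level-suc`, so `Q` would extend
      -- `M`.
      total : ∀ z → ∃[ x ] T (M (z , x))
      total z = stable λ z∉M → extend Q
        (λ (u , _) → u)
        (λ { (u , m , h , refl) (_ , n , h′ , refl) →
               cong (fold true not) (level-unique {z} {m = m} {n} u h h′) })
        (λ { (u , m , h , refl) _ → ∀ᶠ-zip (λ n u′ h′ → inj₂ (u′ , suc m , h′ , refl))
               (uncoloured-summands u) (level-suc {z} {m = m} u h) })
        {z} ((λ x t → z∉M (x , t)) , 0 , ∀⇒∀ᶠ (λ _ → refl) , refl)
        where
        Q : Pred (Ultrafilter × Bool) 0ℓ
        Q (y , x) = Uncoloured y × ∃[ m ] Level-of z m y × x ≡ fold true not m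

    -- `alternating` concerns only the chosen summands of `z`; `sum-unique` carries it over to every
    -- sequence `us`.
    colouring : ∃[ χ ] (∀ {us f z} → IsSum p us f z → ∃[ n ] χ (us n) ≢ χ z)
    colouring = χ , λ {us} {f} {z} Σz →
      let x , t = total z
          n , u≡ , t′ = ∀ᶠ⇒∃ (∀ᶠ-∩ (sum-unique Σz (isSum (us , f , Σz)))
                                    (alternating good t (us , f , Σz)))
      in n , λ same → not-¬ {x} refl $ trans (sym (χ-value t)) $ trans (sym same) $
           trans (cong χ u≡) (χ-value t′)
      where
      M    = proj₁ maximal-good
      good = proj₁ (proj₂ maximal-good)
      open Extension good (proj₂ (proj₂ maximal-good))

      χ : Ultrafilter → Bool
      χ z = proj₁ (total z)

      χ-value : ∀ {z x} → T (M (z , x)) → χ z ≡ x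
      χ-value {z} = functional good (proj₂ (total z))

  -- Finite types, and index functions for discrete sequences.

  listable⇒finite : (xs : List A) → (∀ x → x ∈ˡ xs) → ∃[ n ] (A ↔ Fin n)
  listable⇒finite {A = A} xs x∈xs = length ys , mk↔ₛ′ position (lookup ys)
    (λ i → lookup-injective ys! (sym (lookup-index (x∈ys (lookup ys i)))))
    (λ x → sym (lookup-index (x∈ys x)))
    where
    eq? : (x y : A) → Dec (x ≡ y)
    eq? x y = em

    ys : List A
    ys = deduplicate eq? xs

    ys! : Unique ys
    ys! = DecUnique.deduplicate-! eq? xs

    x∈ys : ∀ x → x ∈ˡ ys
    x∈ys x = ∈-deduplicate⁺ eq? (x∈xs x)

    position : A → Fin (length ys)
    position x = Any.index (x∈ys x)

  ∀ᶠ-below : ∀ {u} {P : ℕ → Pred ℕ b} n → (∀ j → j < n → ∀ᶠ u (P j)) →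
             ∀ᶠ u (λ k → ∀ j → j < n → P j k)
  ∀ᶠ-below zero    _ = ∀⇒∀ᶠ λ k j ()
  ∀ᶠ-below {P = P} (suc n) h = ∀ᶠ-zip
    (λ k below Pn j j<1+n → [ below j , (λ { refl → Pn }) ]′ (m<1+n⇒m<n∨m≡n j<1+n))
    (∀ᶠ-below n λ j j<n → h j (m<n⇒m<1+n j<n)) (h n (n<1+n n))

  -- `f` sends `k` to the first `n` with `k` in `S n`. This is correct on `us n`, which contains
  -- `S n` and omits the finitely many earlier sets.
  discrete⇒fibred : (us : ℕ → Ultrafilter) (S : ℕ → ℘ ℕ) →
                    (∀ n → us n ∋ S n) → (∀ {m n} → m ≢ n → ¬ us m ∋ S n) →
                    ∃[ f ] (∀ n → ∀ᶠ (us n) (λ k → f k ≡ n))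
  discrete⇒fibred us S S∈u S∉u = f , λ n → ∀ᶠ-zip (λ k s below → f-least k n (s , below))
    (∀ᶠ⁺ (S∈u n))
    (∀ᶠ-below n λ j j<n → ¬∀ᶠ⇒∀ᶠ¬ λ Sj∈u → S∉u (λ { refl → <-irrefl refl j<n }) (∀ᶠ⁻ Sj∈u))
    where
    Least : ℕ → ℕ → Set
    Least k n = T (S n k) × (∀ j → j < n → ¬ T (S j k))

    f : ℕ → ℕ
    f k with em {P = ∃[ n ] Least k n}
    ... | yes (n , _) = n
    ... | no _        = 0

    f-least : ∀ k n → Least k n → f k ≡ n
    f-least k n (s , below) with em {P = ∃[ n ] Least k n}
    ... | no ¬∃ = contradiction (n , s , below) ¬∃
    ... | yes (m , s′ , below′) with <-cmp m n
    ...   | tri< m<n _ _ = contradiction s′ (below m m<n)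
    ...   | tri≈ _ e _   = e
    ...   | tri> _ _ n<m = contradiction s (below′ n n<m)

  -- The differences of consecutive sets isolate the terms: terms before `n` omit `S n`, and terms
  -- after `n` contain `S (suc n)`.
  decreasing⇒fibred : (us : ℕ → Ultrafilter) (S : ℕ → ℘ ℕ) → (∀ n → S (suc n) ⊑ S n) →
                      (∀ n → us n ∋ S n) → (∀ n → ¬ us n ∋ S (suc n)) →
                      ∃[ f ] (∀ n → ∀ᶠ (us n) (λ k → f k ≡ n))
  decreasing⇒fibred us S S-step S∈u S∉u = discrete⇒fibred us ring
    (λ n → ∋-meet (us n) (S∈u n)
      ([ (λ t → contradiction t (S∉u n)) , id ]′ (∋-ultra (us n) (S (suc n)))))
    outside
    where
    decrease : ∀ {m n} → m <′ n → S n ⊑ S (suc m)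
    decrease <′-base         k t = t
    decrease (≤′-step m<n) k t = decrease m<n k (S-step _ k t)

    ring : ℕ → ℘ ℕ
    ring n k = S n k ∧ not (S (suc n) k)

    outside : ∀ {m n} → m ≢ n → ¬ us m ∋ ring n
    outside {m} {n} m≢n t with <-cmp m n
    ... | tri< m<n _ _ = S∉u m $ ∋-upward (us m)
      (λ k → decrease (<⇒<′ m<n) k ∘ proj₁ ∘ Equivalence.to T-∧) t
    ... | tri≈ _ m≡n _ = m≢n m≡n
    ... | tri> _ _ n<m = ∋-not (us m) (∋-upward (us m) (decrease (<⇒<′ n<m)) (S∈u m)) $
      ∋-upward (us m) (λ k → proj₂ ∘ Equivalence.to (T-∧ {S n k})) t

  -- Embeddings into βω and discrete sequences with a p-limit.

  BaseOpen : Pred Ultrafilter 0ℓ → Set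
  BaseOpen W = ∀ u → W u → ∃[ S ] u ∋ S × (∀ v → v ∋ S → W v)

  -- `BaseOpen` is openness in `βω`, so this is a topological embedding into `βω`; `initial` says
  -- that the traces of the basic clopen sets form a base of `Y`.
  record Embedding (Y : Space a) : Set (Level.suc a) where
    open Space Y
    field
      ⟦_⟧        : Carrier → Ultrafilter
      injective  : ∀ {x y} → ⟦ x ⟧ ≡ ⟦ y ⟧ → x ≡ y
      continuous : ∀ W → BaseOpen W → ∃[ O ] Open O × O ≐ (⟦_⟧ ⊢ W)
      initial    : ∀ {O y} → Open O → y ∈ O →
                   ∃[ S ] ⟦ y ⟧ ∋ S × (∀ x → ⟦ x ⟧ ∋ S → x ∈ O)

    basic : ∀ S → ∃[ O ] Open O × O ≐ (λ y → ⟦ y ⟧ ∋ S)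
    basic S = continuous (_∋ S) λ u S∈u → S , S∈u , λ v → id

  embedding : ∀ {Y : Space a} {Y′} → Homeomorphism (Subspace ω* Y′) Y → Embedding Y
  embedding {Y = Y} h = record
    { ⟦_⟧        = value ∘ value ∘ from
    ; injective  = λ {x} {y} e → trans (sym (strictlyInverseˡ x))
                     (trans (cong to (value-injective (value-injective e))) (strictlyInverseˡ y))
    ; continuous = λ W W-open → from-continuous _
                     (value ⊢ W , (W , lift W-open , id , id) , id , id)
    ; initial    = λ {O} {y} O-open y∈O →
        let _ , (_ , (_ , lift V₂-open , V₁⊆V₂ , V₂⊆V₁) , W⊆V₁ , V₁⊆W) , W⊆O , O⊆W =
              to-continuous O O-open
            S , S∈y , S⊆V₂ = V₂-open _ (V₁⊆V₂ (W⊆V₁ (O⊆W (subst O (sym (strictlyInverseˡ y)) y∈O))))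
        in S , S∈y , λ x S∈x → subst O (strictlyInverseˡ x) (W⊆O (V₁⊆W (V₂⊆V₁ (S⊆V₂ _ S∈x))))
    }
    where
    open Homeomorphism h
    open Inverse bijection

  record DiscreteLimit (Y : Space a) (p : Ultrafilter) : Set (Level.suc a) where
    open Space Y
    field
      point     : Carrier
      sequence  : ℕ → Carrier
      converge  : ∀ {O} → Open O → point ∈ O → ∀ᶠ p (λ n → sequence n ∈ O)
      nbhd      : ℕ → Pred Carrier a
      nbhd-open : ∀ n → Open (nbhd n)
      ∈-nbhd    : ∀ n → sequence n ∈ nbhd n
      ∉-nbhd    : ∀ {m n} → m ≢ n → sequence m ∉ nbhd n

  module _ {Y : Space a} {p} (L : DiscreteLimit Y p) (E : Embedding Y) where
    open DiscreteLimit L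
    open Embedding E

    limit⇒sum : ∃[ f ] IsSum p (⟦_⟧ ∘ sequence) f ⟦ point ⟧
    limit⇒sum =
      let f , fibres = discrete⇒fibred (⟦_⟧ ∘ sequence) (λ n → proj₁ (local n))
            (λ n → proj₁ (proj₂ (local n)))
            (λ {m} {n} m≢n S∈ → ∉-nbhd m≢n (proj₂ (proj₂ (local n)) _ S∈))
      in f , record
        { fibre = fibres
        ; limit = λ {S} S∈ → let O , O-open , O⊆S , S⊆O = basic S
                             in ∀ᶠ-map (λ n → O⊆S) (converge O-open (S⊆O S∈))
        }
      where
      local : ∀ n → ∃[ S ] ⟦ sequence n ⟧ ∋ S × (∀ x → ⟦ x ⟧ ∋ S → x ∈ nbhd n)
      local n = initial (nbhd-open n) (∈-nbhd n)

  module _ {Y : Space a} (E : Embedding Y) (ys : ℕ → Space.Carrier Y) where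
    open Embedding E

    -- The ultrafilter sought is the image of the accumulation point `y` under the index function
    -- `f`.
    accumulation⇒limit : ∀ {f y} → (∀ n → ∀ᶠ ⟦ ys n ⟧ (λ k → f k ≡ n)) →
                         (∀ {S} → ⟦ y ⟧ ∋ S → ∀ n → ∃[ m ] n ≤ m × ⟦ ys m ⟧ ∋ S) →
                         ∃[ p ] NonPrincipal p × DiscreteLimit Y p
    accumulation⇒limit {f} {y} fibres accumulates = p , p-free , record
      { point     = y
      ; sequence  = ys
      ; converge  = λ O-open y∈O → let S , S∈y , S⊆O = initial O-open y∈O
                                   in ∀ᶠ-map (λ n → S⊆O (ys n)) (p-limit S∈y)
      ; nbhd      = λ n → proj₁ (basic (fibre-of n))
      ; nbhd-open = λ n → proj₁ (proj₂ (basic (fibre-of n)))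
      ; ∈-nbhd    = λ n → proj₂ (proj₂ (proj₂ (basic (fibre-of n)))) (∋⌊⌋ (fibres n))
      ; ∉-nbhd    = λ {m} {n} m≢n h → m≢n (fibre-unique
                      (eventually (proj₁ (proj₂ (proj₂ (basic (fibre-of n)))) h)))
      }
      where
      fibre-of : ℕ → ℘ ℕ
      fibre-of n = ⌊ (λ k → f k ≡ n) ⌋

      fibre-unique : ∀ {m n} → ∀ᶠ ⟦ ys m ⟧ (λ k → f k ≡ n) → m ≡ n
      fibre-unique {m} h = let k , e , e′ = ∀ᶠ⇒∃ (∀ᶠ-∩ (fibres m) h) in trans (sym e) e′

      accumulate : {P : Pred ℕ b} → ∀ᶠ ⟦ y ⟧ P → ∀ n → ∃[ m ] n ≤ m × ∀ᶠ ⟦ ys m ⟧ P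
      accumulate (eventually P∈y) n =
        let m , n≤m , P∈ = accumulates P∈y n in m , n≤m , eventually P∈

      p : Ultrafilter
      p = pushforward f ⟦ y ⟧

      p-free : NonPrincipal p
      p-free n = eventually $ ∋⌊⌋ $ ¬∀ᶠ⇒∀ᶠ¬ {⟦ y ⟧} λ f≡n →
        let m , n<m , h = accumulate f≡n (suc n) in <-irrefl (sym (fibre-unique h)) n<m

      p-limit : ∀ {S} → ⟦ y ⟧ ∋ S → ∀ᶠ p (λ n → ⟦ ys n ⟧ ∋ S)
      p-limit {S} S∈y with ∀ᶠ-ultra {⟦ y ⟧} {P = λ k → ⟦ ys (f k) ⟧ ∋ S}
      ... | inj₁ h = eventually (∋⌊⌋ h)
      ... | inj₂ h =
        -- Some term `ys m` contains both `S` and the set of `k` for which `S` is not in `ys (f k)`;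
        -- but `f` is `m` on `ys m`.
        let m , _ , h′ = accumulate (∀ᶠ-∩ (∀ᶠ⁺ S∈y) h) 0
            _ , e , _ , S∉ = ∀ᶠ⇒∃ (∀ᶠ-∩ (fibres m) h′)
        in ⊥-elim (S∉ (subst (λ i → ⟦ ys i ⟧ ∋ S) (sym e) (∀ᶠ⁻ (∀ᶠ-map (λ _ → proj₁) h′))))

  -- A discrete limit in an infinite countably compact space.

  module _ {Y : Space a} (E : Embedding Y)
           (infinite : Infinite (Space.Carrier Y)) (compact : CountablyCompact Y) where
    open Space Y
    open Embedding E

    -- Infinitely many points of `Y` lie in the clopen set of `S`. Finiteness is put in terms of
    -- lists, so that two finite pieces are joined by `++`.
    Big : ℘ ℕ → Set a
    Big S = ¬ (∃[ ys ] (∀ y → ⟦ y ⟧ ∋ S → y ∈ˡ ys))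

    big-whole : Big (const true)
    big-whole (ys , covers) = infinite (listable⇒finite ys λ y → covers y (∋-whole ⟦ y ⟧))

    big⇒two : ∀ {S} → Big S → ∃[ x ] ∃[ y ] ⟦ x ⟧ ∋ S × ⟦ y ⟧ ∋ S × x ≢ y
    big⇒two big = stable λ none →
      big ([] , λ x S∈x → ⊥-elim $ big (x ∷ [] , λ y S∈y →
        here (stable λ y≢x → none (y , x , S∈y , S∈x , y≢x))))

    Shrinking : ℘ ℕ → Set a
    Shrinking S = ∃[ y ] ∃[ S′ ] Big S′ × S′ ⊑ S × ⟦ y ⟧ ∋ S × ¬ (⟦ y ⟧ ∋ S′)

    -- A set `C` separating two points splits `S`. One half stays big, and the point in the other
    -- half is the one split off.
    shrink : ∀ {S} → Big S → Shrinking S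
    shrink {S} big with x , y , S∈x , S∈y , x≢y ← big⇒two big
                   with C , C∈x , C∉y ← separate (x≢y ∘ injective)
                   with em {P = Big (λ n → S n ∧ C n)}
    ... | yes big∩ = y , _ , big∩ , (λ n → proj₁ ∘ Equivalence.to T-∧) , S∈y ,
      C∉y ∘ ∋-upward ⟦ y ⟧ λ n → proj₂ ∘ Equivalence.to (T-∧ {S n})
    ... | no ¬big∩ = x , (λ n → S n ∧ not (C n)) , big∖ , (λ n → proj₁ ∘ Equivalence.to T-∧) , S∈x ,
      ∋-not ⟦ x ⟧ C∈x ∘ ∋-upward ⟦ x ⟧ λ n → proj₂ ∘ Equivalence.to (T-∧ {S n})
      where
      big∖ : Big (λ n → S n ∧ not (C n))
      big∖ (zs , covers) = ¬big∩ λ (zs′ , covers′) → big (zs ++ zs′ , λ z S∈z →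
        [ (λ C∈z → ∈-++⁺ʳ zs (covers′ z (∋-meet ⟦ z ⟧ S∈z C∈z)))
        , (λ ∁C∈z → ∈-++⁺ˡ (covers z (∋-meet ⟦ z ⟧ S∈z ∁C∈z))) ]′ (∋-ultra ⟦ z ⟧ C))

    stage : ℕ → ∃[ S ] Big S
    stage zero    = const true , big-whole
    stage (suc n) = let _ , S′ , big , _ = shrink (proj₂ (stage n)) in S′ , big

    ys : ℕ → Carrier
    ys n = proj₁ (shrink (proj₂ (stage n)))

    ys-fibred : ∃[ f ] (∀ n → ∀ᶠ ⟦ ys n ⟧ (λ k → f k ≡ n))
    ys-fibred = decreasing⇒fibred (⟦_⟧ ∘ ys) (proj₁ ∘ stage)
      (λ n → let _ , _ , _ , S′⊑S , _ = shrink (proj₂ (stage n)) in S′⊑S)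
      (λ n → let _ , _ , _ , _ , S∈y , _ = shrink (proj₂ (stage n)) in S∈y)
      (λ n → let _ , _ , _ , _ , _ , S′∉y = shrink (proj₂ (stage n)) in S′∉y)

    Isolated : ℕ → Pred Ultrafilter 0ℓ
    Isolated n u = ∃[ S ] u ∋ S × (∀ m → n ≤ m → ¬ (⟦ ys m ⟧ ∋ S))

    -- Without an accumulation point, the sets `Isolated n` would cover `Y`. If `N` bounds the
    -- indices of a finite subcover, `ys N` lies in none of its members.
    accumulation : ∃[ y ] (∀ {S} → ⟦ y ⟧ ∋ S → ∀ n → ∃[ m ] n ≤ m × ⟦ ys m ⟧ ∋ S)
    accumulation = stable λ none →
      let ns , covers = compact (proj₁ ∘ V) (proj₁ ∘ proj₂ ∘ V) λ y → stable λ ¬∃ →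
            none (y , λ {S} S∈y n → stable λ ¬∃m → ¬∃ (n , proj₂ (proj₂ (proj₂ (V n)))
              (S , S∈y , λ m n≤m S∈m → ¬∃m (m , n≤m , S∈m))))
          N = max 0 ns
          n , n∈ns , h = find (covers (ys N))
          S , S∈ , S∉ = proj₁ (proj₂ (proj₂ (V n))) h
      in S∉ N (All.lookup (xs≤max 0 ns) n∈ns) S∈
      where
      V : ∀ n → ∃[ O ] Open O × O ≐ (⟦_⟧ ⊢ Isolated n)
      V n = continuous (Isolated n) λ u (S , S∈u , S∉) → S , S∈u , λ v S∈v → S , S∈v , S∉

    discrete-limit : ∃[ p ] NonPrincipal p × DiscreteLimit Y p
    discrete-limit = accumulation⇒limit E ys (proj₂ ys-fibred) (proj₂ accumulation)

  -- The partition without a homogeneous copy of `Y`.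

  fails : ∀ (Y : Space a) → Infinite (Space.Carrier Y) → CountablyCompact Y → ¬ (ω* ⟶[ Y ]¹₂)
  fails Y infinite compact arrow =
    -- The trivial partition serves only to embed Y into ω*.
    let _ , _ , _ , h₁   = arrow (λ _ _ → ⊤) (λ _ → zero , tt)
        p , p-free , L   = discrete-limit (embedding h₁) infinite compact
        χ , χ-alternates = Colouring.colouring p p-free
        i , Y′ , Y′⊆χᵢ , h₂ = arrow (λ i z → χ (value z) ≡ side i) (λ z → side⁻ (χ (value z)))
        E = embedding h₂
        mono : ∀ y → χ (Embedding.⟦_⟧ E y) ≡ side i
        mono y = monochromatic χ i Y′⊆χᵢ (Inverse.from (Homeomorphism.bijection h₂) y)
        -- `L` was found through the first copy of `Y` and is now read in the second, monochromatic
        -- one.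
        n , χ≢ = χ-alternates (proj₂ (limit⇒sum L E))
    in χ≢ (trans (mono _) (sym (mono _)))
    where
    side : Fin 2 → Bool
    side zero    = true
    side (suc _) = false

    side⁻ : ∀ x → ∃[ i ] x ≡ side i
    side⁻ true  = zero , refl
    side⁻ false = suc zero , refl

    -- Membership in `Y′` is available only irrelevantly; decidability of equality on `Bool`
    -- recovers the colour from it.
    monochromatic : ∀ (χ : Ultrafilter → Bool) i {Y′ : Pred (Space.Carrier ω*) 0ℓ} →
                    Y′ ⊆ (λ z → χ (value z) ≡ side i) →
                    (z : Space.Carrier (Subspace ω* Y′)) → χ (value (value z)) ≡ side i
    monochromatic χ i Y′⊆χᵢ (z , [ z∈Y′ ]) = recompute (χ (value z) Bool.≟ side i) (Y′⊆χᵢ z∈Y′)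

theorem5p14 : (∀ {ℓ} → ExcludedMiddle ℓ) →
    (∀ {a b} → Extensionality a b) →
    ∀ {a} (Y : Space a) →
    Infinite (Space.Carrier Y) →
    CountablyCompact Y →
    ¬ (ω* ⟶[ Y ]¹₂)
theorem5p14 em ext = Classical.fails em ext
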